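{- Let $\theta=\phi(D)$ be a delta operator with poweroids $x^{\{n\}}$. For every formal power series $f$ and every integer $n\ge 1$, $$f(D)\,0^{\{n\}}=\frac{df(D)}{d\theta}\,0^{\{n-1\}}=\cdots=\frac{d^nf(D)}{d\theta^n}\,0^{\{0\}},$$ that is, $f(D)\,0^{\{n\}}=\frac{d^jf(D)}{d\theta^j}\,0^{\{n-j\}}$ for all $0\le j\le n$.
   Context: Work with polynomials in $x$ (real or complex coefficients); $D=d/dx$. A delta operator is $\theta=\phi(D)$, where $\phi(t)=\sum_{\nu\ge1}k_\nu t^\nu$ is a formal power series with $k_1=1$. Its poweroids $x^{\{n\}}$, $n=0,1,2,\dots$, are the unique polynomials with $x^{\{0\}}=1$, $\theta x^{\{n\}}=n\,x^{\{n-1\}}$ for $n\ge1$, and $x^{\{n\}}|_{x=0}=0$ for $n\ge1$. For a formal power series $f$, $f(D)\,0^{\{n\}}$ denotes $\big(f(D)x^{\{n\}}\big)\big|_{x=0}$. The derivative $\frac{d^jf(D)}{d\theta^j}$ means: regard $f(D)=f(\phi^{ -1}(\theta))$ as a formal power series in $\theta$ ($\phi^{ -1}$ being the compositional inverse of $\phi$), differentiate $j$ times with respect to $\theta$, and regard the result again as a power series in $D$; e.g. $\frac{df(D)}{d\theta}=f'(D)/\phi'(D)$. -}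

module Defs where

open import Algebra.Bundles using (CommutativeRing)
open import Algebra.Apartness.Bundles using (HeytingField; HeytingCommutativeRing)
import Algebra.Definitions.RawMonoid as RawMonoidDefs
import Algebra.Properties.Monoid.Sum as SumProperties
import Relation.Binary.Reasoning.Setoid as SetoidReasoning
open import Data.Fin.Base using (Fin; zero; suc; toℕ; inject₁; fromℕ)
open import Data.Fin.Properties using (toℕ-inject₁; toℕ-fromℕ; toℕ<n)
open import Data.List.Base using (List; []; _∷_; length; map; foldr; applyUpTo)
open import Data.Nat.Base using (ℕ; zero; suc; _∸_; _<_; _≤_; z≤n; s≤s)
import Data.Nat.Properties as ℕₚ
open import Data.Nat.GeneralisedArithmetic using (fold)
import Relation.Binary.PropositionalEquality.Core as ≡
open import Relation.Nullary.Decidable.Core using (yes; no)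
open import Relation.Nullary.Negation.Core using (contradiction)

module _ {c ℓ₁ ℓ₂} (K : HeytingField c ℓ₁ ℓ₂) where
  private module K = HeytingField K

  ringOf : CommutativeRing c ℓ₁
  ringOf = HeytingCommutativeRing.commutativeRing K.heytingCommutativeRing

  CharacteristicZero : Set ℓ₂
  CharacteristicZero = ∀ n → (suc n × K.1#) K.# K.0#
    where open RawMonoidDefs (CommutativeRing.+-rawMonoid ringOf) using (_×_)

module Umbral {c ℓ} (R : CommutativeRing c ℓ) where

  open CommutativeRing R
  open RawMonoidDefs +-rawMonoid using (_×_; sum)

  -- Formal power series: f n is the coefficient of tⁿ (not of tⁿ/n!).

  Series : Set c
  Series = ℕ → Carrier

  infix 4 _≈ₛ_
  _≈ₛ_ : Series → Series → Set ℓ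
  f ≈ₛ g = ∀ n → f n ≈ g n

  oneₛ : Series
  oneₛ zero    = 1#
  oneₛ (suc _) = 0#

  varₛ : Series
  varₛ zero    = 0#
  varₛ (suc n) = oneₛ n

  infixl 7 _*ₛ_
  _*ₛ_ : Series → Series → Series
  (f *ₛ g) n = sum {suc n} λ i → f (toℕ i) * g (n ∸ toℕ i)

  infixr 8 _^ₛ_
  _^ₛ_ : Series → ℕ → Series
  f ^ₛ zero  = oneₛ
  f ^ₛ suc k = f *ₛ (f ^ₛ k)

  -- f(g(t)).  Only meaningful when g has zero constant term: then gᵏ has no
  -- terms below tᵏ, so the sum over k may stop at k = n.
  infixr 9 _∘ₛ_
  _∘ₛ_ : Series → Series → Series
  (f ∘ₛ g) n = sum {suc n} λ k → f (toℕ k) * (g ^ₛ toℕ k) n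

  derivativeₛ : Series → Series
  derivativeₛ f n = suc n × f (suc n)

  record IsDeltaSeries (φ : Series) : Set ℓ where
    field
      constant≈0 : φ 0 ≈ 0#
      linear≈1   : φ 1 ≈ 1#

  -- The coefficients of φ⁻¹, obtained by solving φ⁻¹(φ(t)) = t degree by
  -- degree.  inverseBelow φ n agrees with φ⁻¹ below tⁿ and vanishes from tⁿ on;
  -- because the coefficient of tⁿ in φ(t)ⁿ is 1, the next coefficient is the
  -- error at tⁿ.  See inverse-∘ₛ below.
  inverseBelow : Series → ℕ → Series
  inverseBelow φ zero    k = 0#
  inverseBelow φ (suc n) k with k ℕₚ.≟ n
  ... | yes _ = varₛ n - (inverseBelow φ n ∘ₛ φ) n
  ... | no  _ = inverseBelow φ n k

  inverse : Series → Series
  inverse φ n = varₛ n - (inverseBelow φ n ∘ₛ φ) n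

  -- dʲf(D)/dθʲ for θ = φ(D): expand f in powers of θ as f(φ⁻¹(θ)),
  -- differentiate j times in θ, and substitute θ = φ(D) back.
  θ-derivative : Series → ℕ → Series → Series
  θ-derivative φ j f = fold (f ∘ₛ inverse φ) derivativeₛ j ∘ₛ φ

  -- Polynomials: coefficient lists, constant term first.  Trailing zeros are
  -- allowed, so equality is equality of all coefficients.

  Poly : Set c
  Poly = List Carrier

  coeff : Poly → ℕ → Carrier
  coeff []      _       = 0#
  coeff (a ∷ p) zero    = a
  coeff (a ∷ p) (suc n) = coeff p n

  infix 4 _≈ₚ_
  _≈ₚ_ : Poly → Poly → Set ℓ
  p ≈ₚ q = ∀ n → coeff p n ≈ coeff q n

  oneₚ : Poly
  oneₚ = 1# ∷ []

  infixl 6 _+ₚ_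
  _+ₚ_ : Poly → Poly → Poly
  []      +ₚ q       = q
  (a ∷ p) +ₚ []      = a ∷ p
  (a ∷ p) +ₚ (b ∷ q) = (a + b) ∷ (p +ₚ q)

  infixr 7 _·ₚ_
  _·ₚ_ : Carrier → Poly → Poly
  a ·ₚ p = map (a *_) p

  eval : Poly → Carrier → Carrier
  eval []      x = 0#
  eval (a ∷ p) x = a + x * eval p x

  -- weighted k [a₀, a₁, …] = [k a₀, (k+1) a₁, …]
  weighted : ℕ → Poly → Poly
  weighted k []      = []
  weighted k (a ∷ p) = (k × a) ∷ weighted (suc k) p

  D : Poly → Poly
  D []      = []
  D (a ∷ p) = weighted 1 p

  -- f(D) p = Σₖ fₖ Dᵏ p.  The sum stops at length p since D shortens
  -- coefficient lists, so that Dᵏ p = 0 for k ≥ length p.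
  infixr 8 _⟨D⟩_
  _⟨D⟩_ : Series → Poly → Poly
  f ⟨D⟩ p = foldr _+ₚ_ [] (applyUpTo (λ k → f k ·ₚ fold p D k) (length p))

  record IsPoweroids (φ : Series) (x^ : ℕ → Poly) : Set ℓ where
    field
      initial : x^ 0 ≈ₚ oneₚ
      lowered : ∀ n → φ ⟨D⟩ x^ (suc n) ≈ₚ (suc n × 1#) ·ₚ x^ n
      at-zero : ∀ n → eval (x^ (suc n)) 0# ≈ 0#

  -- (f(D) p) at x = 0.
  infix 8 _⟨D⟩_∣₀
  _⟨D⟩_∣₀ : Series → Poly → Carrier
  f ⟨D⟩ p ∣₀ = eval (f ⟨D⟩ p) 0#

  module _ {φ : Series} (δ : IsDeltaSeries φ) where
    open IsDeltaSeries δ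
    open SumProperties +-monoid using (sum-cong-≋; sum-init-last; sum-replicate-zero)
    open SetoidReasoning setoid

    private
      sum-zero : ∀ n {t : Fin n → Carrier} → (∀ i → t i ≈ 0#) → sum t ≈ 0#
      sum-zero n t≈0 = trans (sum-cong-≋ t≈0) (sum-replicate-zero n)

      0*-≈0 : ∀ {a} b → a ≈ 0# → a * b ≈ 0#
      0*-≈0 b a≈0 = trans (*-congʳ a≈0) (zeroˡ b)

      *0-≈0 : ∀ a {b} → b ≈ 0# → a * b ≈ 0#
      *0-≈0 a b≈0 = trans (*-congˡ b≈0) (zeroʳ a)

    ^ₛ-low : ∀ k {m} → m < k → (φ ^ₛ k) m ≈ 0#
    ^ₛ-low (suc k) {m} (s≤s m≤k) = sum-zero (suc m) (term m m≤k)
      where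
      term : ∀ m → m ≤ k → (i : Fin (suc m)) →
             φ (toℕ i) * (φ ^ₛ k) (m ∸ toℕ i) ≈ 0#
      term m       _    zero    = 0*-≈0 _ constant≈0
      term (suc m) m<k  (suc i) =
        *0-≈0 _ (^ₛ-low k (ℕₚ.≤-trans (s≤s (ℕₚ.m∸n≤m m (toℕ i))) m<k))

    ^ₛ-leading : ∀ k → (φ ^ₛ k) k ≈ 1#
    ^ₛ-leading zero    = refl
    ^ₛ-leading (suc k) = begin
      φ 0 * (φ ^ₛ k) (suc k) + (φ 1 * (φ ^ₛ k) k + rest k)
        ≈⟨ +-cong (0*-≈0 _ constant≈0)
                  (+-cong (*-cong linear≈1 (^ₛ-leading k)) (rest≈0 k)) ⟩
      0# + (1# * 1# + 0#)  ≈⟨ +-identityˡ _ ⟩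
      1# * 1# + 0#         ≈⟨ +-identityʳ _ ⟩
      1# * 1#              ≈⟨ *-identityˡ 1# ⟩
      1#                   ∎
      where
      rest : ℕ → Carrier
      rest k = sum {k} λ i → φ (suc (suc (toℕ i))) * (φ ^ₛ k) (k ∸ suc (toℕ i))
      rest≈0 : ∀ k → rest k ≈ 0#
      rest≈0 zero    = refl
      rest≈0 (suc k) = sum-zero (suc k) λ i →
        *0-≈0 (φ (suc (suc (toℕ i)))) (^ₛ-low (suc k) (s≤s (ℕₚ.m∸n≤m k (toℕ i))))

    inverseBelow-low : ∀ n {k} → k < n → inverseBelow φ n k ≈ inverse φ k
    inverseBelow-low (suc n) {k} (s≤s k≤n) with k ℕₚ.≟ n
    ... | yes ≡.refl = refl
    ... | no  k≢n    = inverseBelow-low n (ℕₚ.≤∧≢⇒< k≤n k≢n)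

    inverseBelow-high : ∀ n {k} → n ≤ k → inverseBelow φ n k ≈ 0#
    inverseBelow-high zero    _   = refl
    inverseBelow-high (suc n) {k} n<k with k ℕₚ.≟ n
    ... | yes ≡.refl = contradiction n<k (ℕₚ.<-irrefl ≡.refl)
    ... | no  _      = inverseBelow-high n (ℕₚ.<⇒≤ n<k)

    private
      ∘ₛ-last : ∀ f n → (f ∘ₛ φ) n ≈
                sum {n} (λ k → f (toℕ k) * (φ ^ₛ toℕ k) n) + f n
      ∘ₛ-last f n = begin
        (f ∘ₛ φ) n
          ≈⟨ sum-init-last {n} (λ k → f (toℕ k) * (φ ^ₛ toℕ k) n) ⟩
        sum {n} (λ k → term (toℕ (inject₁ k))) + term (toℕ (fromℕ n))
          ≈⟨ +-cong (sum-cong-≋ {n} λ k → reflexive (≡.cong term (toℕ-inject₁ k)))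
                    (reflexive (≡.cong term (toℕ-fromℕ n))) ⟩
        sum {n} (λ k → term (toℕ k)) + f n * (φ ^ₛ n) n
          ≈⟨ +-congˡ (trans (*-congˡ (^ₛ-leading n)) (*-identityʳ (f n))) ⟩
        sum {n} (λ k → term (toℕ k)) + f n ∎
        where
        term : ℕ → Carrier
        term k = f k * (φ ^ₛ k) n

    inverse-∘ₛ : inverse φ ∘ₛ φ ≈ₛ varₛ
    inverse-∘ₛ n = begin
      (inverse φ ∘ₛ φ) n
        ≈⟨ ∘ₛ-last (inverse φ) n ⟩
      sum {n} (λ k → inverse φ (toℕ k) * (φ ^ₛ toℕ k) n) + inverse φ n
        ≈⟨ +-congʳ (sum-cong-≋ {n} λ k → *-congʳ (sym (inverseBelow-low n (toℕ<n k)))) ⟩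
      s + inverse φ n
        ≈⟨ +-congʳ (sym error) ⟩
      e + (varₛ n - e)
        ≈⟨ +-comm e _ ⟩
      (varₛ n - e) + e
        ≈⟨ +-assoc _ _ _ ⟩
      varₛ n + (- e + e)
        ≈⟨ +-congˡ (-‿inverseˡ e) ⟩
      varₛ n + 0#
        ≈⟨ +-identityʳ _ ⟩
      varₛ n ∎
      where
      e s : Carrier
      e = (inverseBelow φ n ∘ₛ φ) n
      s = sum {n} λ k → inverseBelow φ n (toℕ k) * (φ ^ₛ toℕ k) n
      error : e ≈ s
      error = begin
        e                          ≈⟨ ∘ₛ-last (inverseBelow φ n) n ⟩
        s + inverseBelow φ n n     ≈⟨ +-congˡ (inverseBelow-high n ℕₚ.≤-refl) ⟩
        s + 0#                     ≈⟨ +-identityʳ s ⟩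
        s                          ∎

{-# OPTIONS --safe #-}

-- Expand f(D) = g(θ) with g = f ∘ φ⁻¹.  Splitting off the constant term,
-- g(θ) = g₀ + θ h(θ), and applying both sides to x^{n} at x = 0 kills g₀ when
-- n ≥ 1 and leaves n · h(θ) 0^{n-1}; hence g(θ) 0^{n} = n! gₙ.  Both sides of
-- the theorem are therefore the n-th derivative of g at 0.  Identities of power
-- series are proved coefficient by coefficient, using that the coefficient of
-- tⁿ in φ h only involves coefficients of h below n.
module Submission where

open import Defs
open import Algebra.Apartness.Bundles using (HeytingField)
open import Algebra.Bundles using (CommutativeRing)
import Algebra.Definitions.RawMonoid as RawMonoidDefs
import Algebra.Properties.CommutativeMonoid.Mult as CommutativeMonoidMult
import Algebra.Properties.Semiring.Mult as SemiringMult
import Algebra.Properties.Semiring.Sum as SemiringSum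
import Algebra.Solver.Ring.NaturalCoefficients.Default as NaturalCoefficients
open import Data.Fin.Base using (toℕ)
open import Data.List.Base using ([]; _∷_; length; foldr; applyUpTo)
import Data.Nat.Base as ℕ
open import Data.Nat.Base using (ℕ; zero; suc; _∸_; _<_; _≤_; z≤n; s≤s; _⊔_; _!)
open import Data.Nat.GeneralisedArithmetic using (fold)
import Data.Nat.Properties as ℕₚ
import Relation.Binary.PropositionalEquality.Core as ≡
import Relation.Binary.Reasoning.Setoid as SetoidReasoning

module _ {c ℓ} (R : CommutativeRing c ℓ) where

  open CommutativeRing R hiding (zero)
  open RawMonoidDefs +-rawMonoid using (_×_; sum)
  open CommutativeMonoidMult +-commutativeMonoid using (×-distrib-+)
  open SemiringMult semiring using (×-congʳ; ×-congˡ; ×-assocˡ; ×-assoc-*; ×-comm-*)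
  open SemiringSum semiring using (sum-cong-≋)
  open NaturalCoefficients commutativeSemiring using (solve; _:+_; _:*_; _:=_; con)
  open SetoidReasoning setoid
  open Umbral R

  -- Shifts and linear combinations of series.

  n×0≈0 : ∀ n → n × 0# ≈ 0#
  n×0≈0 zero    = refl
  n×0≈0 (suc n) = trans (+-identityˡ _) (n×0≈0 n)

  zeroₛ : Series
  zeroₛ _ = 0#

  -- This is (f - f₀)/t. Writing f = f₀ + t · `shift f` drives the inductions on series below, and
  -- it matches how the sums in `_*ₛ_` and `_∘ₛ_` compute.
  shift : Series → Series
  shift f n = f (suc n)

  infix 6 _·_+ₛ_
  -- Scaling and addition are merged so that one lemma per operation gives linearity. The form is
  -- that of `shift (f *ₛ g)`, which is definitionally `f 0 · shift g +ₛ shift f *ₛ g`.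
  _·_+ₛ_ : Carrier → Series → Series → Series
  (c · f +ₛ g) n = c * f n + g n

  sum-0#* : ∀ N (p : Series) → sum {N} (λ k → 0# * p (toℕ k)) ≈ 0#
  sum-0#* zero    p = refl
  sum-0#* (suc N) p = trans (+-cong (zeroˡ _) (sum-0#* N (shift p))) (+-identityʳ _)

  sum-*-linear : ∀ N c (f g p : Series) →
    sum {N} (λ k → (c * f (toℕ k) + g (toℕ k)) * p (toℕ k)) ≈
    c * sum {N} (λ k → f (toℕ k) * p (toℕ k)) + sum {N} (λ k → g (toℕ k) * p (toℕ k))
  sum-*-linear zero    c f g p = sym (trans (+-identityʳ _) (zeroʳ c))
  sum-*-linear (suc N) c f g p = trans (+-congˡ (sum-*-linear N c (shift f) (shift g) (shift p)))
    (solve 6 (λ c f g p x y → (c :* f :+ g) :* p :+ (c :* x :+ y)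
                           := c :* (f :* p :+ x) :+ (g :* p :+ y))
      refl c (f 0) (g 0) (p 0) _ _)

  -- Multiplication of series

  *ₛ-cong : ∀ f f′ g g′ n → f ≈ₛ f′ → (∀ {m} → m ≤ n → g m ≈ g′ m) →
            (f *ₛ g) n ≈ (f′ *ₛ g′) n
  *ₛ-cong f f′ g g′ n f≈f′ g≈g′ =
    sum-cong-≋ {suc n} λ i → *-cong (f≈f′ (toℕ i)) (g≈g′ (ℕₚ.m∸n≤m n (toℕ i)))

  -- The top coefficient `g n` occurs only multiplied by `φ 0`, which vanishes. The strict bound on
  -- m is what lets the later inductions on the degree descend.
  *ₛ-congʳ-below : ∀ φ g h n → φ 0 ≈ 0# → (∀ {m} → m < n → g m ≈ h m) →
                   (φ *ₛ g) n ≈ (φ *ₛ h) n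
  *ₛ-congʳ-below φ g h n φ₀≈0 g≈h = go n g≈h
    where
    head≈ : ∀ x y → φ 0 * x ≈ φ 0 * y
    head≈ x y = trans (trans (*-congʳ φ₀≈0) (zeroˡ x))
                      (sym (trans (*-congʳ φ₀≈0) (zeroˡ y)))
    go : ∀ n → (∀ {m} → m < n → g m ≈ h m) → (φ *ₛ g) n ≈ (φ *ₛ h) n
    go zero    _   = +-congʳ (head≈ _ _)
    go (suc n) g≈h = +-cong (head≈ _ _)
      (*ₛ-cong (shift φ) (shift φ) g h n (λ _ → refl) λ m≤n → g≈h (s≤s m≤n))

  *ₛ-linearˡ : ∀ c f g h → (c · f +ₛ g) *ₛ h ≈ₛ (c · f *ₛ h +ₛ g *ₛ h)
  *ₛ-linearˡ c f g h zero    =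
    solve 4 (λ c f g h → (c :* f :+ g) :* h :+ con 0
                      := c :* (f :* h :+ con 0) :+ (g :* h :+ con 0))
      refl c (f 0) (g 0) (h 0)
  *ₛ-linearˡ c f g h (suc n) = trans
    (+-congˡ (*ₛ-linearˡ c (shift f) (shift g) h n))
    (solve 6 (λ c f g h x y → (c :* f :+ g) :* h :+ (c :* x :+ y)
                           := c :* (f :* h :+ x) :+ (g :* h :+ y))
      refl c (f 0) (g 0) (h (suc n)) _ _)

  *ₛ-linearʳ : ∀ c f g h → h *ₛ (c · f +ₛ g) ≈ₛ (c · h *ₛ f +ₛ h *ₛ g)
  *ₛ-linearʳ c f g h zero    =
    solve 4 (λ c f g h → h :* (c :* f :+ g) :+ con 0
                      := c :* (h :* f :+ con 0) :+ (h :* g :+ con 0))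
      refl c (f 0) (g 0) (h 0)
  *ₛ-linearʳ c f g h (suc n) = trans
    (+-congˡ (*ₛ-linearʳ c f g (shift h) n))
    (solve 6 (λ c f g h x y → h :* (c :* f :+ g) :+ (c :* x :+ y)
                           := c :* (h :* f :+ x) :+ (h :* g :+ y))
      refl c (f (suc n)) (g (suc n)) (h 0) _ _)

  *ₛ-assoc : ∀ f g h → (f *ₛ g) *ₛ h ≈ₛ f *ₛ (g *ₛ h)
  *ₛ-assoc f g h zero    =
    solve 3 (λ f g h → (f :* g :+ con 0) :* h :+ con 0
                    := f :* (g :* h :+ con 0) :+ con 0)
      refl (f 0) (g 0) (h 0)
  *ₛ-assoc f g h (suc n) = begin
    (f 0 * g 0 + 0#) * h (suc n) + ((f 0 · shift g +ₛ shift f *ₛ g) *ₛ h) n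
      ≈⟨ +-congˡ (*ₛ-linearˡ (f 0) (shift g) (shift f *ₛ g) h n) ⟩
    (f 0 * g 0 + 0#) * h (suc n) + (f 0 * (shift g *ₛ h) n + ((shift f *ₛ g) *ₛ h) n)
      ≈⟨ +-congˡ (+-congˡ (*ₛ-assoc (shift f) g h n)) ⟩
    (f 0 * g 0 + 0#) * h (suc n) + (f 0 * (shift g *ₛ h) n + (shift f *ₛ (g *ₛ h)) n)
      ≈⟨ solve 5 (λ f g h x y → (f :* g :+ con 0) :* h :+ (f :* x :+ y)
                             := f :* (g :* h :+ x) :+ y)
           refl (f 0) (g 0) (h (suc n)) _ _ ⟩
    f 0 * (g 0 * h (suc n) + (shift g *ₛ h) n) + (shift f *ₛ (g *ₛ h)) n ∎

  *ₛ-zeroˡ : ∀ f → zeroₛ *ₛ f ≈ₛ zeroₛ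
  *ₛ-zeroˡ f zero    = trans (+-identityʳ _) (zeroˡ _)
  *ₛ-zeroˡ f (suc n) = trans (+-cong (zeroˡ _) (*ₛ-zeroˡ f n)) (+-identityʳ _)

  *ₛ-zeroʳ : ∀ f → f *ₛ zeroₛ ≈ₛ zeroₛ
  *ₛ-zeroʳ f zero    = trans (+-identityʳ _) (zeroʳ _)
  *ₛ-zeroʳ f (suc n) = trans (+-cong (zeroʳ _) (*ₛ-zeroʳ (shift f) n)) (+-identityʳ _)

  *ₛ-identityˡ : ∀ f → oneₛ *ₛ f ≈ₛ f
  *ₛ-identityˡ f zero    = trans (+-identityʳ _) (*-identityˡ _)
  *ₛ-identityˡ f (suc n) =
    trans (+-cong (*-identityˡ _) (*ₛ-zeroˡ f n)) (+-identityʳ _)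

  varₛ-*ₛ : ∀ f n → (varₛ *ₛ f) (suc n) ≈ f n
  varₛ-*ₛ f n = trans (+-cong (zeroˡ _) (*ₛ-identityˡ f n)) (+-identityˡ _)

  *ₛ-distribˡ-sum : ∀ N (h f : Series) (P : ℕ → Series) n →
    sum {N} (λ k → f (toℕ k) * (h *ₛ P (toℕ k)) n) ≈
    (h *ₛ (λ m → sum {N} λ k → f (toℕ k) * P (toℕ k) m)) n
  *ₛ-distribˡ-sum zero    h f P n = sym (*ₛ-zeroʳ h n)
  *ₛ-distribˡ-sum (suc N) h f P n = trans
    (+-congˡ (*ₛ-distribˡ-sum N h (shift f) (λ k → P (suc k)) n))
    (sym (*ₛ-linearʳ (f 0) (P 0) (λ m → sum {N} λ k → f (suc (toℕ k)) * P (suc (toℕ k)) m) h n))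

  -- Composition of series

  -- In `(f ∘ₛ φ) n` the cutoff is tied to the degree n. Here the two are separate, so that a sum
  -- with fixed cutoff is itself a series and can be multiplied by φ.
  partialComp : Series → ℕ → Series → Series
  partialComp φ N f n = sum {N} λ k → f (toℕ k) * (φ ^ₛ toℕ k) n

  -- Horner's rule: every power of φ after the zeroth has a factor φ, which is pulled out of the
  -- sum.
  partialComp-suc : ∀ φ N f → partialComp φ (suc N) f ≈ₛ
                    (f 0 · oneₛ +ₛ φ *ₛ partialComp φ N (shift f))
  partialComp-suc φ N f n = +-congˡ (*ₛ-distribˡ-sum N φ (shift f) (φ ^ₛ_) n)

  module _ (φ : Series) (φ₀≈0 : φ 0 ≈ 0#) where

    -- Powers of φ beyond the n-th have no term in degree n. By Horner's rule, the factor φ passes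
    -- the claim to degrees strictly below n, so both cutoffs can drop by one.
    partialComp-stable : ∀ M N f {n} → n < M → n < N →
                         partialComp φ M f n ≈ partialComp φ N f n
    partialComp-stable (suc M) (suc N) f {n} (s≤s n≤M) (s≤s n≤N) = begin
      partialComp φ (suc M) f n
        ≈⟨ partialComp-suc φ M f n ⟩
      f 0 * oneₛ n + (φ *ₛ partialComp φ M (shift f)) n
        ≈⟨ +-congˡ (*ₛ-congʳ-below φ (partialComp φ M (shift f)) (partialComp φ N (shift f)) n φ₀≈0
             λ m<n →
             partialComp-stable M N (shift f)
               (ℕₚ.<-≤-trans m<n n≤M) (ℕₚ.<-≤-trans m<n n≤N)) ⟩
      f 0 * oneₛ n + (φ *ₛ partialComp φ N (shift f)) n
        ≈⟨ partialComp-suc φ N f n ⟨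
      partialComp φ (suc N) f n ∎

    ∘ₛ-unfold : ∀ f → f ∘ₛ φ ≈ₛ (f 0 · oneₛ +ₛ φ *ₛ (shift f ∘ₛ φ))
    ∘ₛ-unfold f n = trans (partialComp-suc φ n f n)
      -- Horner's rule leaves the cutoff n, whereas `shift f ∘ₛ φ` cuts off at `suc m` in degree m;
      -- for m < n both suffice.
      (+-congˡ (*ₛ-congʳ-below φ (partialComp φ n (shift f)) (shift f ∘ₛ φ) n φ₀≈0 λ {m} m<n →
        partialComp-stable n (suc m) (shift f) m<n ℕₚ.≤-refl))

    ∘ₛ-congˡ : ∀ f g → f ≈ₛ g → f ∘ₛ φ ≈ₛ g ∘ₛ φ
    ∘ₛ-congˡ f g f≈g n = sum-cong-≋ {suc n} λ k → *-congʳ {x = (φ ^ₛ toℕ k) n} (f≈g (toℕ k))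

    ∘ₛ-linear : ∀ c f g → (c · f +ₛ g) ∘ₛ φ ≈ₛ (c · f ∘ₛ φ +ₛ g ∘ₛ φ)
    ∘ₛ-linear c f g n = sum-*-linear (suc n) c f g (λ k → (φ ^ₛ k) n)

    ∘ₛ-constantTerm : ∀ f → (f ∘ₛ φ) 0 ≈ f 0
    ∘ₛ-constantTerm f = trans (+-identityʳ _) (*-identityʳ _)

    ∘ₛ-*ₛ : ∀ f g → (f *ₛ g) ∘ₛ φ ≈ₛ (f ∘ₛ φ) *ₛ (g ∘ₛ φ)
    ∘ₛ-*ₛ f g n = below (suc n) f g ℕₚ.≤-refl
      where
      -- The bound N turns strong induction on the degree into structural recursion: the factor φ in
      -- `∘ₛ-unfold` leads to `shift f` in degrees m < n.
      below : ∀ N f g {n} → n < N → ((f *ₛ g) ∘ₛ φ) n ≈ ((f ∘ₛ φ) *ₛ (g ∘ₛ φ)) n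
      below (suc N) f g {n} (s≤s n≤N) = begin
        ((f *ₛ g) ∘ₛ φ) n
          ≈⟨ ∘ₛ-unfold (f *ₛ g) n ⟩
        (f 0 * g 0 + 0#) * oneₛ n + (φ *ₛ ((f 0 · shift g +ₛ shift f *ₛ g) ∘ₛ φ)) n
          ≈⟨ +-congˡ (*ₛ-congʳ-below φ ((f 0 · shift g +ₛ shift f *ₛ g) ∘ₛ φ)
                 (f 0 · shift g ∘ₛ φ +ₛ (shift f ∘ₛ φ) *ₛ (g ∘ₛ φ)) n φ₀≈0 λ {m} m<n →
               trans (∘ₛ-linear (f 0) (shift g) (shift f *ₛ g) m)
                     (+-congˡ (below N (shift f) g (ℕₚ.<-≤-trans m<n n≤N)))) ⟩
        (f 0 * g 0 + 0#) * oneₛ n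
          + (φ *ₛ (f 0 · shift g ∘ₛ φ +ₛ (shift f ∘ₛ φ) *ₛ (g ∘ₛ φ))) n
          ≈⟨ +-congˡ (*ₛ-linearʳ (f 0) (shift g ∘ₛ φ) ((shift f ∘ₛ φ) *ₛ (g ∘ₛ φ)) φ n) ⟩
        (f 0 * g 0 + 0#) * oneₛ n
          + (f 0 * (φ *ₛ (shift g ∘ₛ φ)) n + (φ *ₛ ((shift f ∘ₛ φ) *ₛ (g ∘ₛ φ))) n)
          ≈⟨ solve 5 (λ f g o x y → (f :* g :+ con 0) :* o :+ (f :* x :+ y)
                                 := f :* (g :* o :+ x) :+ y)
               refl (f 0) (g 0) (oneₛ n) _ _ ⟩
        f 0 * (g 0 * oneₛ n + (φ *ₛ (shift g ∘ₛ φ)) n)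
          + (φ *ₛ ((shift f ∘ₛ φ) *ₛ (g ∘ₛ φ))) n
          ≈⟨ +-cong (*-congˡ (trans (sym (∘ₛ-unfold g n)) (sym (*ₛ-identityˡ (g ∘ₛ φ) n))))
                    (sym (*ₛ-assoc φ (shift f ∘ₛ φ) (g ∘ₛ φ) n)) ⟩
        f 0 * (oneₛ *ₛ (g ∘ₛ φ)) n + ((φ *ₛ (shift f ∘ₛ φ)) *ₛ (g ∘ₛ φ)) n
          ≈⟨ *ₛ-linearˡ (f 0) oneₛ (φ *ₛ (shift f ∘ₛ φ)) (g ∘ₛ φ) n ⟨
        ((f 0 · oneₛ +ₛ φ *ₛ (shift f ∘ₛ φ)) *ₛ (g ∘ₛ φ)) n
          ≈⟨ *ₛ-cong (f 0 · oneₛ +ₛ φ *ₛ (shift f ∘ₛ φ)) (f ∘ₛ φ) (g ∘ₛ φ) (g ∘ₛ φ) n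
               (λ m → sym (∘ₛ-unfold f m)) (λ _ → refl) ⟩
        ((f ∘ₛ φ) *ₛ (g ∘ₛ φ)) n ∎

    oneₛ-∘ₛ : oneₛ ∘ₛ φ ≈ₛ oneₛ
    oneₛ-∘ₛ n = begin
      (oneₛ ∘ₛ φ) n                               ≈⟨ ∘ₛ-unfold oneₛ n ⟩
      1# * oneₛ n + (φ *ₛ (zeroₛ ∘ₛ φ)) n         ≈⟨ +-cong (*-identityˡ _) φ*0≈0 ⟩
      oneₛ n + 0#                                 ≈⟨ +-identityʳ _ ⟩
      oneₛ n                                      ∎
      where
      φ*0≈0 : (φ *ₛ (zeroₛ ∘ₛ φ)) n ≈ 0#
      φ*0≈0 = trans (*ₛ-cong φ φ (zeroₛ ∘ₛ φ) zeroₛ n (λ _ → refl)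
                            (λ {m} _ → sum-0#* (suc m) (λ k → (φ ^ₛ k) m)))
                   (*ₛ-zeroʳ φ n)

  -- Unfold f(ψ) = f₀ + ψ · (`shift f`)(ψ) and substitute φ. Since ψ(φ(t)) = t, the coefficient at
  -- `suc n` is the coefficient at n of the same expression for `shift f`, which gives an induction
  -- on the degree.
  ∘ₛ-leftInverse : ∀ φ ψ → φ 0 ≈ 0# → ψ 0 ≈ 0# → ψ ∘ₛ φ ≈ₛ varₛ →
                   ∀ f → (f ∘ₛ ψ) ∘ₛ φ ≈ₛ f
  ∘ₛ-leftInverse φ ψ φ₀≈0 ψ₀≈0 ψ∘φ≈t = cancel
    where
    unfold : ∀ f n → ((f ∘ₛ ψ) ∘ₛ φ) n ≈
             f 0 * oneₛ n + (varₛ *ₛ ((shift f ∘ₛ ψ) ∘ₛ φ)) n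
    unfold f n = begin
      ((f ∘ₛ ψ) ∘ₛ φ) n
        ≈⟨ ∘ₛ-congˡ φ φ₀≈0 (f ∘ₛ ψ) (f 0 · oneₛ +ₛ ψ *ₛ (shift f ∘ₛ ψ)) (∘ₛ-unfold ψ ψ₀≈0 f) n ⟩
      ((f 0 · oneₛ +ₛ ψ *ₛ (shift f ∘ₛ ψ)) ∘ₛ φ) n
        ≈⟨ ∘ₛ-linear φ φ₀≈0 (f 0) oneₛ (ψ *ₛ (shift f ∘ₛ ψ)) n ⟩
      f 0 * (oneₛ ∘ₛ φ) n + ((ψ *ₛ (shift f ∘ₛ ψ)) ∘ₛ φ) n
        ≈⟨ +-cong (*-congˡ (oneₛ-∘ₛ φ φ₀≈0 n))
             (trans (∘ₛ-*ₛ φ φ₀≈0 ψ (shift f ∘ₛ ψ) n)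
                    (*ₛ-cong (ψ ∘ₛ φ) varₛ ((shift f ∘ₛ ψ) ∘ₛ φ) ((shift f ∘ₛ ψ) ∘ₛ φ) n
                      ψ∘φ≈t (λ _ → refl))) ⟩
      f 0 * oneₛ n + (varₛ *ₛ ((shift f ∘ₛ ψ) ∘ₛ φ)) n ∎
    cancel : ∀ f → (f ∘ₛ ψ) ∘ₛ φ ≈ₛ f
    cancel f zero    = trans (∘ₛ-constantTerm φ φ₀≈0 (f ∘ₛ ψ)) (∘ₛ-constantTerm ψ ψ₀≈0 f)
    cancel f (suc n) = begin
      ((f ∘ₛ ψ) ∘ₛ φ) (suc n)
        ≈⟨ unfold f (suc n) ⟩
      f 0 * 0# + (varₛ *ₛ ((shift f ∘ₛ ψ) ∘ₛ φ)) (suc n)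
        ≈⟨ +-cong (zeroʳ _) (varₛ-*ₛ ((shift f ∘ₛ ψ) ∘ₛ φ) n) ⟩
      0# + ((shift f ∘ₛ ψ) ∘ₛ φ) n
        ≈⟨ +-identityˡ _ ⟩
      ((shift f ∘ₛ ψ) ∘ₛ φ) n
        ≈⟨ cancel (shift f) n ⟩
      f (suc n) ∎

  -- Differential operators on coefficient sequences

  derivativeₛ-cong : ∀ {f g} → f ≈ₛ g → derivativeₛ f ≈ₛ derivativeₛ g
  derivativeₛ-cong f≈g n = ×-congʳ (suc n) (f≈g (suc n))

  derivativeₛ-linear : ∀ c f g →
    derivativeₛ (c · f +ₛ g) ≈ₛ (c · derivativeₛ f +ₛ derivativeₛ g)
  derivativeₛ-linear c f g n = trans (×-distrib-+ (c * f (suc n)) (g (suc n)) (suc n))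
    (+-congʳ (sym (×-comm-* (suc n) c (f (suc n)))))

  -- Such a sequence plays the role of a polynomial of degree below N. The bound is a parameter
  -- because the length of a coefficient list is not determined by its coefficients.
  VanishesFrom : ℕ → Series → Set ℓ
  VanishesFrom N a = ∀ {n} → N ≤ n → a n ≈ 0#

  derivativeₛ-vanishes : ∀ {N a} → VanishesFrom (suc N) a → VanishesFrom N (derivativeₛ a)
  derivativeₛ-vanishes a≈0 {n} N≤n = trans (×-congʳ (suc n) (a≈0 (s≤s N≤n))) (n×0≈0 (suc n))

  -- Σ_{k<N} fₖ Dᵏ; on a polynomial of degree below N this is f(D).
  truncatedOp : ℕ → Series → Series → Series
  truncatedOp zero    f a n = 0#
  truncatedOp (suc N) f a n = f 0 * a n + truncatedOp N (shift f) (derivativeₛ a) n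

  truncatedOp-cong : ∀ N {f g a b} → f ≈ₛ g → a ≈ₛ b → truncatedOp N f a ≈ₛ truncatedOp N g b
  truncatedOp-cong zero    f≈g a≈b n = refl
  truncatedOp-cong (suc N) f≈g a≈b n = +-cong (*-cong (f≈g 0) (a≈b n))
    (truncatedOp-cong N (λ k → f≈g (suc k)) (derivativeₛ-cong a≈b) n)

  truncatedOp-linearˡ : ∀ N c f g a →
    truncatedOp N (c · f +ₛ g) a ≈ₛ (c · truncatedOp N f a +ₛ truncatedOp N g a)
  truncatedOp-linearˡ zero    c f g a n = sym (trans (+-identityʳ _) (zeroʳ c))
  truncatedOp-linearˡ (suc N) c f g a n = trans
    (+-congˡ (truncatedOp-linearˡ N c (shift f) (shift g) (derivativeₛ a) n))
    (solve 6 (λ c f g a x y → (c :* f :+ g) :* a :+ (c :* x :+ y)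
                           := c :* (f :* a :+ x) :+ (g :* a :+ y))
      refl c (f 0) (g 0) (a n) _ _)

  truncatedOp-linearʳ : ∀ N c f a b →
    truncatedOp N f (c · a +ₛ b) ≈ₛ (c · truncatedOp N f a +ₛ truncatedOp N f b)
  truncatedOp-linearʳ zero    c f a b n = sym (trans (+-identityʳ _) (zeroʳ c))
  truncatedOp-linearʳ (suc N) c f a b n = trans
    (+-congˡ (trans (truncatedOp-cong N (λ _ → refl) (derivativeₛ-linear c a b) n)
                    (truncatedOp-linearʳ N c (shift f) (derivativeₛ a) (derivativeₛ b) n)))
    (solve 6 (λ c f a b x y → f :* (c :* a :+ b) :+ (c :* x :+ y)
                           := c :* (f :* a :+ x) :+ (f :* b :+ y))
      refl c (f 0) (a n) (b n) _ _)

  -- Each derivative lowers the bound by one, so the terms from the M-th on annihilate `a`.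
  truncatedOp-stable : ∀ {M N} f {a} → VanishesFrom M a → M ≤ N →
                       truncatedOp N f a ≈ₛ truncatedOp M f a
  truncatedOp-stable {N = zero}  f a≈0 z≤n n = refl
  truncatedOp-stable {N = suc N} f {a} a≈0 z≤n n = trans
    (+-cong (trans (*-congˡ (a≈0 z≤n)) (zeroʳ _))
            (truncatedOp-stable (shift f) (derivativeₛ-vanishes {a = a} λ {m} _ → a≈0 {m} z≤n)
              (z≤n {N}) n))
    (+-identityʳ _)
  truncatedOp-stable f a≈0 (s≤s M≤N) n =
    +-congˡ (truncatedOp-stable (shift f) (derivativeₛ-vanishes a≈0) M≤N n)

  truncatedOp-zeroˡ : ∀ N a → truncatedOp N zeroₛ a ≈ₛ zeroₛ
  truncatedOp-zeroˡ zero    a n = refl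
  truncatedOp-zeroˡ (suc N) a n =
    trans (+-cong (zeroˡ _) (truncatedOp-zeroˡ N (derivativeₛ a) n)) (+-identityʳ _)

  truncatedOp-oneₛ : ∀ N {a} → VanishesFrom N a → truncatedOp N oneₛ a ≈ₛ a
  truncatedOp-oneₛ zero    a≈0 n = sym (a≈0 z≤n)
  truncatedOp-oneₛ (suc N) {a} _ n =
    trans (+-cong (*-identityˡ _) (truncatedOp-zeroˡ N (derivativeₛ a) n)) (+-identityʳ _)

  truncatedOp-·ʳ : ∀ N c f a n →
    truncatedOp N f (λ m → c * a m) n ≈ c * truncatedOp N f a n
  truncatedOp-·ʳ N c f a n = begin
    truncatedOp N f (λ m → c * a m) n
      ≈⟨ truncatedOp-cong N (λ _ → refl) (λ m → sym (+-identityʳ _)) n ⟩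
    truncatedOp N f (c · a +ₛ zeroₛ) n
      ≈⟨ truncatedOp-linearʳ N c f a zeroₛ n ⟩
    c * truncatedOp N f a n + truncatedOp N f zeroₛ n
      -- The zero sequence vanishes from degree 0, so the cutoff can be lowered to 0, where the sum
      -- is empty.
      ≈⟨ +-congˡ (truncatedOp-stable f (λ _ → refl) (z≤n {N}) n) ⟩
    c * truncatedOp N f a n + 0#
      ≈⟨ +-identityʳ _ ⟩
    c * truncatedOp N f a n ∎

  truncatedOp-vanishes : ∀ {M} N f {a} → VanishesFrom M a → VanishesFrom M (truncatedOp N f a)
  truncatedOp-vanishes zero    f a≈0 M≤n = refl
  truncatedOp-vanishes (suc N) f a≈0 M≤n = trans
    (+-cong (trans (*-congˡ (a≈0 M≤n)) (zeroʳ _))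
            (truncatedOp-vanishes N (shift f)
              (derivativeₛ-vanishes λ M<n → a≈0 (ℕₚ.<⇒≤ M<n)) M≤n))
    (+-identityʳ _)

  -- Multiplying series composes operators, with f(D) applied first. Composing two truncations also
  -- produces powers of D from the N-th on, but these annihilate `a`.
  truncatedOp-*ₛ : ∀ N f g {a} → VanishesFrom N a →
    truncatedOp N (f *ₛ g) a ≈ₛ truncatedOp N g (truncatedOp N f a)
  truncatedOp-*ₛ zero    f g     a≈0 n = refl
  truncatedOp-*ₛ (suc N) f g {a} a≈0 n = begin
    (f 0 * g 0 + 0#) * a n + truncatedOp N (f 0 · shift g +ₛ shift f *ₛ g) a′ n
      ≈⟨ +-congˡ (truncatedOp-linearˡ N (f 0) (shift g) (shift f *ₛ g) a′ n) ⟩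
    (f 0 * g 0 + 0#) * a n
      + (f 0 * truncatedOp N (shift g) a′ n + truncatedOp N (shift f *ₛ g) a′ n)
      ≈⟨ solve 5 (λ f g a x y → (f :* g :+ con 0) :* a :+ (f :* x :+ y)
                             := f :* (g :* a :+ x) :+ y)
           refl (f 0) (g 0) (a n) _ _ ⟩
    f 0 * truncatedOp (suc N) g a n + truncatedOp N (shift f *ₛ g) a′ n
      ≈⟨ +-congˡ (truncatedOp-*ₛ N (shift f) g a′≈0 n) ⟩
    f 0 * truncatedOp (suc N) g a n + truncatedOp N g b n
      -- The induction on a′ yields cutoff N; it may be raised to `suc N` because b still vanishes
      -- from N.
      ≈⟨ +-congˡ (truncatedOp-stable g (truncatedOp-vanishes N (shift f) a′≈0)
                    (ℕₚ.n≤1+n N) n) ⟨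
    f 0 * truncatedOp (suc N) g a n + truncatedOp (suc N) g b n
      ≈⟨ truncatedOp-linearʳ (suc N) (f 0) g a b n ⟨
    truncatedOp (suc N) g (f 0 · a +ₛ b) n ∎
    where
    a′ b : Series
    a′ = derivativeₛ a
    b  = truncatedOp N (shift f) a′
    a′≈0 : VanishesFrom N a′
    a′≈0 = derivativeₛ-vanishes a≈0

  -- Differential operators on polynomials

  coeff-vanishes : ∀ p → VanishesFrom (length p) (coeff p)
  coeff-vanishes []      _         = refl
  coeff-vanishes (a ∷ p) (s≤s p≤n) = coeff-vanishes p p≤n

  coeff-+ₚ : ∀ p q n → coeff (p +ₚ q) n ≈ coeff p n + coeff q n
  coeff-+ₚ []      q       n       = sym (+-identityˡ _)
  coeff-+ₚ (a ∷ p) []      n       = sym (+-identityʳ _)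
  coeff-+ₚ (a ∷ p) (b ∷ q) zero    = refl
  coeff-+ₚ (a ∷ p) (b ∷ q) (suc n) = coeff-+ₚ p q n

  coeff-·ₚ : ∀ a p n → coeff (a ·ₚ p) n ≈ a * coeff p n
  coeff-·ₚ a []      n       = sym (zeroʳ a)
  coeff-·ₚ a (b ∷ p) zero    = refl
  coeff-·ₚ a (b ∷ p) (suc n) = coeff-·ₚ a p n

  coeff-weighted : ∀ k p n → coeff (weighted k p) n ≈ (k ℕ.+ n) × coeff p n
  coeff-weighted k []      n       = sym (n×0≈0 (k ℕ.+ n))
  coeff-weighted k (a ∷ p) zero    = ×-congˡ (≡.sym (ℕₚ.+-identityʳ k))
  coeff-weighted k (a ∷ p) (suc n) =
    trans (coeff-weighted (suc k) p n) (×-congˡ (≡.sym (ℕₚ.+-suc k n)))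

  coeff-D : ∀ p → coeff (D p) ≈ₛ derivativeₛ (coeff p)
  coeff-D []      n = sym (n×0≈0 (suc n))
  coeff-D (a ∷ p) n = coeff-weighted 1 p n

  eval-0# : ∀ p → eval p 0# ≈ coeff p 0
  eval-0# []      = refl
  eval-0# (a ∷ p) = trans (+-congˡ (zeroˡ _)) (+-identityʳ a)

  -- The iterates of D are generalised to any q whose coefficients satisfy the same recursion, so
  -- that the induction can pass to the tail of q.
  coeff-combination : ∀ N f (q : ℕ → Poly) →
    (∀ k → coeff (q (suc k)) ≈ₛ derivativeₛ (coeff (q k))) →
    coeff (foldr _+ₚ_ [] (applyUpTo (λ k → f k ·ₚ q k) N)) ≈ₛ truncatedOp N f (coeff (q 0))
  coeff-combination zero    f q q′ n = refl
  coeff-combination (suc N) f q q′ n = trans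
    (coeff-+ₚ (f 0 ·ₚ q 0) _ n)
    (+-cong (coeff-·ₚ (f 0) (q 0) n)
      (trans (coeff-combination N (shift f) (λ k → q (suc k)) (λ k → q′ (suc k)) n)
             (truncatedOp-cong N (λ _ → refl) (q′ 0) n)))

  coeff-⟨D⟩ : ∀ {N} f p → VanishesFrom N (coeff p) →
              coeff (f ⟨D⟩ p) ≈ₛ truncatedOp N f (coeff p)
  coeff-⟨D⟩ {N} f p p≈0 n = begin
    coeff (f ⟨D⟩ p) n
      ≈⟨ coeff-combination (length p) f (fold p D) (λ k → coeff-D (fold p D k)) n ⟩
    truncatedOp (length p) f (coeff p) n
      -- The cutoffs `length p` and N need not be comparable, so both are compared with their
      -- maximum.
      ≈⟨ truncatedOp-stable f (coeff-vanishes p) (ℕₚ.m≤m⊔n (length p) N) n ⟨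
    truncatedOp (length p ⊔ N) f (coeff p) n
      ≈⟨ truncatedOp-stable f p≈0 (ℕₚ.m≤n⊔m (length p) N) n ⟩
    truncatedOp N f (coeff p) n ∎

  ⟨D⟩∣₀ : ∀ {N} f p → VanishesFrom N (coeff p) →
          f ⟨D⟩ p ∣₀ ≈ truncatedOp N f (coeff p) 0
  ⟨D⟩∣₀ f p p≈0 = trans (eval-0# (f ⟨D⟩ p)) (coeff-⟨D⟩ f p p≈0 0)

  ⟨D⟩∣₀-congˡ : ∀ {f g} p → f ≈ₛ g → f ⟨D⟩ p ∣₀ ≈ g ⟨D⟩ p ∣₀
  ⟨D⟩∣₀-congˡ {f} {g} p f≈g = begin
    f ⟨D⟩ p ∣₀                              ≈⟨ ⟨D⟩∣₀ f p (coeff-vanishes p) ⟩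
    truncatedOp (length p) f (coeff p) 0    ≈⟨ truncatedOp-cong (length p) f≈g (λ _ → refl) 0 ⟩
    truncatedOp (length p) g (coeff p) 0    ≈⟨ ⟨D⟩∣₀ g p (coeff-vanishes p) ⟨
    g ⟨D⟩ p ∣₀                              ∎

  -- Poweroids

  -- Up to the factorial, a coefficient is a derivative at 0: both sides are the derivative of `a`
  -- of order m + j there. The factor `suc m` from the outermost derivative turns m! into (m+1)!,
  -- and the induction goes on with smaller j and larger m.
  factorial-derivativeₛ : ∀ a j m →
    (m !) × fold a derivativeₛ j m ≈ ((m ℕ.+ j) !) × a (m ℕ.+ j)
  factorial-derivativeₛ a zero    m =
    reflexive (≡.cong (λ k → (k !) × a k) (≡.sym (ℕₚ.+-identityʳ m)))
  factorial-derivativeₛ a (suc j) m = begin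
    (m !) × (suc m × fold a derivativeₛ j (suc m))
      ≈⟨ ×-assocˡ _ (m !) (suc m) ⟩
    (m ! ℕ.* suc m) × fold a derivativeₛ j (suc m)
      ≈⟨ ×-congˡ (ℕₚ.*-comm (m !) (suc m)) ⟩
    (suc m !) × fold a derivativeₛ j (suc m)
      ≈⟨ factorial-derivativeₛ a j (suc m) ⟩
    ((suc m ℕ.+ j) !) × a (suc m ℕ.+ j)
      ≈⟨ reflexive (≡.cong (λ k → (k !) × a k) (≡.sym (ℕₚ.+-suc m j))) ⟩
    ((m ℕ.+ suc j) !) × a (m ℕ.+ suc j) ∎

  module _ {φ : Series} (δ : IsDeltaSeries φ)
           {x^ : ℕ → Poly} (poweroids : IsPoweroids φ x^) where

    open IsDeltaSeries δ
    open IsPoweroids poweroids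

    ∘ₛ-⟨D⟩-poweroid-suc : ∀ g n →
      g ∘ₛ φ ⟨D⟩ x^ (suc n) ∣₀ ≈ suc n × (shift g ∘ₛ φ ⟨D⟩ x^ n ∣₀)
    ∘ₛ-⟨D⟩-poweroid-suc g n = begin
      g ∘ₛ φ ⟨D⟩ p ∣₀
        ≈⟨ ⟨D⟩∣₀ (g ∘ₛ φ) p p≈0 ⟩
      truncatedOp N (g ∘ₛ φ) (coeff p) 0
        ≈⟨ truncatedOp-cong N (∘ₛ-unfold φ constant≈0 g) (λ _ → refl) 0 ⟩
      truncatedOp N (g 0 · oneₛ +ₛ φ *ₛ h) (coeff p) 0
        ≈⟨ truncatedOp-linearˡ N (g 0) oneₛ (φ *ₛ h) (coeff p) 0 ⟩
      g 0 * truncatedOp N oneₛ (coeff p) 0 + truncatedOp N (φ *ₛ h) (coeff p) 0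
        -- The g₀ term evaluates p at 0 and so vanishes by `at-zero`. In the other term θ acts
        -- first, which makes `lowered` applicable.
        ≈⟨ +-cong (trans (*-congˡ constantTerm≈0) (zeroʳ _))
                  (truncatedOp-*ₛ N φ h p≈0 0) ⟩
      0# + truncatedOp N h (truncatedOp N φ (coeff p)) 0
        ≈⟨ +-identityˡ _ ⟩
      truncatedOp N h (truncatedOp N φ (coeff p)) 0
        ≈⟨ truncatedOp-cong N (λ _ → refl) lowered′ 0 ⟩
      truncatedOp N h (λ m → (suc n × 1#) * coeff q m) 0
        ≈⟨ truncatedOp-·ʳ N (suc n × 1#) h (coeff q) 0 ⟩
      (suc n × 1#) * truncatedOp N h (coeff q) 0
        ≈⟨ ×-assoc-* (suc n) 1# _ ⟩
      suc n × (1# * truncatedOp N h (coeff q) 0)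
        ≈⟨ ×-congʳ (suc n) (*-identityˡ _) ⟩
      suc n × truncatedOp N h (coeff q) 0
        ≈⟨ ×-congʳ (suc n) (⟨D⟩∣₀ h q q≈0) ⟨
      suc n × (h ⟨D⟩ q ∣₀) ∎
      where
      p q : Poly
      p = x^ (suc n)
      q = x^ n
      h : Series
      h = shift g ∘ₛ φ
      N : ℕ
      -- One cutoff serves both polynomials, since `lowered` replaces p by q inside an operator of
      -- fixed cutoff.
      N = length p ⊔ length q
      p≈0 : VanishesFrom N (coeff p)
      p≈0 N≤m = coeff-vanishes p (ℕₚ.≤-trans (ℕₚ.m≤m⊔n (length p) (length q)) N≤m)
      q≈0 : VanishesFrom N (coeff q)
      q≈0 N≤m = coeff-vanishes q (ℕₚ.≤-trans (ℕₚ.m≤n⊔m (length p) (length q)) N≤m)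
      constantTerm≈0 : truncatedOp N oneₛ (coeff p) 0 ≈ 0#
      constantTerm≈0 =
        trans (truncatedOp-oneₛ N p≈0 0) (trans (sym (eval-0# p)) (at-zero n))
      lowered′ : ∀ m → truncatedOp N φ (coeff p) m ≈ (suc n × 1#) * coeff q m
      lowered′ m =
        trans (sym (coeff-⟨D⟩ φ p p≈0 m)) (trans (lowered n m) (coeff-·ₚ _ q m))

    ∘ₛ-⟨D⟩-poweroid : ∀ g n → g ∘ₛ φ ⟨D⟩ x^ n ∣₀ ≈ (n !) × g n
    ∘ₛ-⟨D⟩-poweroid g zero    = begin
      g ∘ₛ φ ⟨D⟩ x^ 0 ∣₀
        -- The list `x^ 0` may carry trailing zeros; bounding it by the length of `oneₚ` leaves a
        -- single term. The last expression of the chain unfolds to `g 0 + 0#`.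
        ≈⟨ ⟨D⟩∣₀ (g ∘ₛ φ) (x^ 0) (λ {m} 1≤m → trans (initial m) (coeff-vanishes oneₚ 1≤m)) ⟩
      (g ∘ₛ φ) 0 * coeff (x^ 0) 0 + 0#
        ≈⟨ +-congʳ (*-cong (∘ₛ-constantTerm φ constant≈0 g) (initial 0)) ⟩
      g 0 * 1# + 0#
        ≈⟨ +-congʳ (*-identityʳ _) ⟩
      (0 !) × g 0 ∎
    ∘ₛ-⟨D⟩-poweroid g (suc n) = begin
      g ∘ₛ φ ⟨D⟩ x^ (suc n) ∣₀                   ≈⟨ ∘ₛ-⟨D⟩-poweroid-suc g n ⟩
      suc n × (shift g ∘ₛ φ ⟨D⟩ x^ n ∣₀)         ≈⟨ ×-congʳ (suc n) (∘ₛ-⟨D⟩-poweroid (shift g) n) ⟩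
      suc n × ((n !) × g (suc n))                ≈⟨ ×-assocˡ _ (suc n) (n !) ⟩
      (suc n !) × g (suc n)                      ∎

    ∘ₛ-inverse-∘ₛ : ∀ f → (f ∘ₛ inverse φ) ∘ₛ φ ≈ₛ f
    ∘ₛ-inverse-∘ₛ = ∘ₛ-leftInverse φ (inverse φ) constant≈0 inverse₀≈0 (inverse-∘ₛ δ)
      where
      inverse₀≈0 : inverse φ 0 ≈ 0#
      -- Composition with φ preserves the constant term, and that of φ⁻¹(φ(t)) = t is 0.
      inverse₀≈0 = trans (sym (∘ₛ-constantTerm φ constant≈0 (inverse φ))) (inverse-∘ₛ δ 0)

    θ-derivative-poweroid : ∀ f n j → j ≤ n →
      f ⟨D⟩ x^ n ∣₀ ≈ θ-derivative φ j f ⟨D⟩ x^ (n ∸ j) ∣₀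
    θ-derivative-poweroid f n j j≤n = begin
      f ⟨D⟩ x^ n ∣₀
        ≈⟨ ⟨D⟩∣₀-congˡ (x^ n) (∘ₛ-inverse-∘ₛ f) ⟨
      g ∘ₛ φ ⟨D⟩ x^ n ∣₀
        ≈⟨ ∘ₛ-⟨D⟩-poweroid g n ⟩
      (n !) × g n
        ≈⟨ reflexive (≡.cong (λ k → (k !) × g k) (≡.sym (ℕₚ.m∸n+n≡m j≤n))) ⟩
      ((n ∸ j ℕ.+ j) !) × g (n ∸ j ℕ.+ j)
        ≈⟨ factorial-derivativeₛ g j (n ∸ j) ⟨
      ((n ∸ j) !) × fold g derivativeₛ j (n ∸ j)
        -- By definition `θ-derivative φ j f` is the j-th derivative of g composed with φ, so the
        -- evaluation formula applies to that derivative.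
        ≈⟨ ∘ₛ-⟨D⟩-poweroid (fold g derivativeₛ j) (n ∸ j) ⟨
      θ-derivative φ j f ⟨D⟩ x^ (n ∸ j) ∣₀ ∎
      where
      g : Series
      g = f ∘ₛ inverse φ

theoremD : ∀ {c ℓ₁ ℓ₂} (K : HeytingField c ℓ₁ ℓ₂) → CharacteristicZero K →
    let open HeytingField K using (_≈_)
        open Umbral (ringOf K) in
    (φ : Series) → IsDeltaSeries φ →
    (x^ : ℕ → Poly) → IsPoweroids φ x^ →
    (f : Series) (n : ℕ) → 1 ≤ n →
    (j : ℕ) → j ≤ n →
    f ⟨D⟩ x^ n ∣₀ ≈ θ-derivative φ j f ⟨D⟩ x^ (n ∸ j) ∣₀
theoremD K _ φ δ x^ poweroids f n _ j j≤n =
  θ-derivative-poweroid (ringOf K) δ poweroids f n j j≤n
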